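{- Let $k \geq 2$ be an even integer, let $m$ be a positive integer, and let $q$ be a prime power such that $q \equiv k+1 \pmod{2k}$. If $\mathcal{K}_m(G_k(q))=0$, then $q<R_{\frac{k}{2}}(m)$.
   Context: $\mathbb{F}_q$ is the finite field with $q$ elements and $S_k \subset \mathbb{F}_q^*$ is the subgroup of nonzero $k$-th powers (of order $\frac{q-1}{k}$). The $k$-th power Paley digraph $G_k(q)$ has vertex set $\mathbb{F}_q$, and $a \to b$ is an edge if and only if $b-a \in S_k$ (the condition on $q$ gives $-1 \notin S_k$, so there is at most one edge between any two vertices). For a digraph $G$, $\mathcal{K}_m(G)$ is the number of transitive subtournaments of order $m$ contained in $G$; a tournament of order $m$ is transitive if its vertices can be listed $a_1,\dots,a_m$ with $a_i \to a_j$ for all $i<j$. The multicolor directed Ramsey number $R(n_1,n_2,\dots,n_t)$ is the smallest integer $N$ such that any tournament of order $N$ whose edges have been colored with $t$ colors contains, for some $1 \leq i \leq t$, a transitive subtournament of order $n_i$ all of whose edges have color $i$ (these numbers exist). $R_t(n)$ denotes $R(n,n,\dots,n)$ with $t$ arguments; for $t=1$ this is the usual directed Ramsey number $R(n)$ for tournaments. -}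

module Defs where

open import Level using (Level; _⊔_; 0ℓ) renaming (suc to lsuc)
open import Algebra.Bundles using (CommutativeRing)
import Algebra.Properties.Semiring.Exp as Exp
open import Data.Fin.Base using (Fin)
open import Data.Fin.Properties using (_≟_; any?; all?)
open import Data.Fin.Subset using (Subset; inside; outside; _∈_)
open import Data.Fin.Subset.Properties using (_∈?_)
open import Data.List.Base as List using (List; _++_; length; filter)
open import Data.Nat.Base as ℕ using (ℕ; zero; suc; _≤_)
open import Data.Nat.Divisibility using (_∣_)
open import Data.Nat.Primality using (Prime)
open import Data.Product.Base using (∃; ∃-syntax; _×_; _,_)
open import Data.Sum.Base using (_⊎_)
open import Data.Vec.Base using (Vec; []; _∷_; lookup)
import Data.Vec.Membership.Propositional as Vec
open import Data.Vec.Membership.DecPropositional using () renaming (_∈?_ to ∈ᵥ-dec)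
open import Data.Vec.Relation.Unary.AllPairs using (AllPairs; allPairs?)
open import Data.Vec.Relation.Unary.Unique.Propositional using (Unique)
open import Function.Bundles using (Inverse; _⇔_; mk⇔; Equivalence)
open import Relation.Binary.Core using (Rel)
open import Relation.Binary.Definitions using (Decidable)
open import Relation.Binary.PropositionalEquality as ≡ using (_≡_; _≢_)
open import Relation.Nullary using (¬_; Dec)
open import Relation.Nullary.Decidable
  using (map′; ¬?; _×-dec_; _→-dec_)
import Relation.Unary as U

private variable
  a ℓ p : Level
  n t : ℕ

IsPrimePower : ℕ → Set
IsPrimePower q = ∃[ p ] ∃[ e ] Prime p × 1 ≤ e × q ≡ p ℕ.^ e

infix 4 _≡_[mod_]

_≡_[mod_] : ℕ → ℕ → ℕ → Set
x ≡ y [mod d ] = d ∣ ℕ.∣ x - y ∣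

record FiniteField (a ℓ : Level) (q : ℕ) : Set (lsuc (a ⊔ ℓ)) where
  field
    commutativeRing : CommutativeRing a ℓ
  open CommutativeRing commutativeRing public
  field
    0≉1         : ¬ (0# ≈ 1#)
    inverse     : ∀ x → ¬ (x ≈ 0#) → ∃[ y ] x * y ≈ 1#
    enumeration : Inverse (≡.setoid (Fin q)) setoid

  open Exp semiring public using (_^_)

  element : Fin q → Carrier
  element = Inverse.to enumeration

  index : Carrier → Fin q
  index = Inverse.from enumeration

  _≈?_ : Decidable _≈_
  x ≈? y = map′
    (λ eq → trans (sym (Inverse.strictlyInverseˡ enumeration x))
              (trans (Inverse.to-cong enumeration eq)
                (Inverse.strictlyInverseˡ enumeration y)))
    (Inverse.from-cong enumeration)
    (index x ≟ index y)

  NonzeroPower : ℕ → Carrier → Set (a ⊔ ℓ)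
  NonzeroPower k y = ¬ (y ≈ 0#) × ∃[ x ] x ^ k ≈ y

  nonzeroPower? : ∀ k → U.Decidable (NonzeroPower k)
  nonzeroPower? k y = ¬? (y ≈? 0#) ×-dec map′
    (λ (i , eq) → element i , eq)
    (λ (x , eq) → index x ,
      trans (Exp.^-congˡ semiring k (Inverse.strictlyInverseˡ enumeration x)) eq)
    (any? (λ i → (element i ^ k) ≈? y))

record Digraph (ℓ : Level) (n : ℕ) : Set (lsuc ℓ) where
  infix 4 _⟶_ _⟶?_
  field
    _⟶_  : Rel (Fin n) ℓ
    _⟶?_ : Decidable _⟶_

-- The vertices 𝔽_q are labelled by Fin q through the enumeration of the field.
paleyDigraph : ∀ {q} → ℕ → FiniteField a ℓ q → Digraph (a ⊔ ℓ) q
paleyDigraph k F = record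
  { _⟶_  = λ u v → NonzeroPower k (element v - element u)
  ; _⟶?_ = λ u v → nonzeroPower? k (element v - element u)
  } where open FiniteField F

Lists : Subset n → ∀ {m} → Vec (Fin n) m → Set
Lists W vs = Unique vs × (∀ v → v ∈ W ⇔ v Vec.∈ vs)

-- In a digraph with at most one edge between any two vertices, such as a
-- Paley digraph or a tournament, a subtournament is determined by its vertex
-- set W.  AllPairs _⟶_ (a₁ ∷ … ∷ aₘ ∷ []) says that aᵢ ⟶ aⱼ for all i < j.
TransitiveSubtournament : Digraph ℓ n → ℕ → Subset n → Set ℓ
TransitiveSubtournament {n = n} G m W =
  ∃[ vs ] Lists W {m} vs × AllPairs _⟶_ vs
  where open Digraph G

anyVec? : ∀ {m} {P : U.Pred (Vec (Fin n) m) p} → U.Decidable P → Dec (∃ P)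
anyVec? {m = zero}  P? = map′ ([] ,_) (λ { ([] , p) → p }) (P? [])
anyVec? {m = suc m} P? = map′
  (λ (v , vs , p) → v ∷ vs , p)
  (λ { (v ∷ vs , p) → v , vs , p })
  (any? (λ v → anyVec? (λ vs → P? (v ∷ vs))))

lists? : (W : Subset n) → ∀ {m} → U.Decidable (Lists W {m})
lists? W vs =
  allPairs? (λ u v → ¬? (u ≟ v)) vs ×-dec
  all? (λ v → map′ (λ (f , g) → mk⇔ f g)
                   (λ e → Equivalence.to e , Equivalence.from e)
                   ((v ∈? W →-dec ∈ᵥ-dec _≟_ v vs) ×-dec
                    (∈ᵥ-dec _≟_ v vs →-dec v ∈? W)))

transitiveSubtournament? : (G : Digraph ℓ n) (m : ℕ) →
                           U.Decidable (TransitiveSubtournament G m)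
transitiveSubtournament? G m W =
  anyVec? (λ vs → lists? W vs ×-dec allPairs? _⟶?_ vs)
  where open Digraph G

allSubsets : ∀ n → List (Subset n)
allSubsets zero    = [] List.∷ List.[]
allSubsets (suc n) = List.map (inside ∷_) (allSubsets n) ++
                     List.map (outside ∷_) (allSubsets n)

𝒦 : ℕ → Digraph ℓ n → ℕ
𝒦 {n = n} m G = length (filter (transitiveSubtournament? G m) (allSubsets n))

record IsTournament (G : Digraph ℓ n) : Set ℓ where
  open Digraph G
  field
    loopless  : ∀ v → ¬ (v ⟶ v)
    connected : ∀ u v → u ≢ v → u ⟶ v ⊎ v ⟶ u
    oriented  : ∀ u v → ¬ (u ⟶ v × v ⟶ u)

-- The proof of u ⟶ v is irrelevant, so that a colour is attached to the edge
-- itself and not to the evidence for it.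
Colouring : Digraph ℓ n → ℕ → Set ℓ
Colouring {n = n} G t = (u v : Fin n) → .(u ⟶ v) → Fin t
  where open Digraph G

Monochromatic : (G : Digraph ℓ n) → Colouring G t → Fin t → Subset n → Set ℓ
Monochromatic G colour i W =
  ∀ u v → u ∈ W → v ∈ W → (e : u ⟶ v) → colour u v e ≡ i
  where open Digraph G

RamseyProperty : Vec ℕ t → ℕ → Set₁
RamseyProperty {t = t} ns N =
  (T : Digraph 0ℓ N) → IsTournament T → (colour : Colouring T t) →
  ∃[ i ] ∃[ W ] TransitiveSubtournament T (lookup ns i) W ×
                Monochromatic T colour i W

-- N = R(n₁,…,n_t)
IsRamseyNumber : Vec ℕ t → ℕ → Set₁
IsRamseyNumber ns N = RamseyProperty ns N × (∀ M → RamseyProperty ns M → N ≤ M)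

{-# OPTIONS --safe #-}
module Submission where

-- The idea is to colour a tournament on field elements by the class of v - u
-- modulo k-th powers, taken up to sign.
--
-- Call x and y equivalent, x ~ y, when they differ by a nonzero k-th power as a
-- factor.  There are at most k classes of nonzero elements: if r ranges over
-- pairwise inequivalent ones and x over the q - 1 units, then (r , x) ↦ r xᵏ
-- takes each value at most k times, since Xᵏ - c has at most k roots
-- (classes-≤-k).  This bound makes the cyclicity of the multiplicative group
-- unnecessary.  Write q = 1 + k d; the congruence on q says that d is odd.  Then
-- -1 is not a k-th power (x≁-x): otherwise, raising to the power d would give
-- 1 = -1 by Fermat's theorem, whereas q · 1 = 0 and q is odd.  Hence the classes
-- come in pairs {C , -C}, and there are r₁ , … , r_{k/2} such that each nonzero x
-- is equivalent to some rᵢ or to some -rᵢ, and never to both an rᵢ and a -rⱼ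
-- (representatives).
--
-- If R ≤ q, then Fin R embeds into the field.  Draw u ⟶ v when v - u ~ rᵢ for
-- some i, and give this edge the colour i.  This is a tournament coloured with
-- k/2 colours, so the Ramsey property yields a transitive subtournament of order
-- m of a single colour i.  Multiplying its vertices by rᵢ⁻¹ turns the differences
-- along its edges into k-th powers, which gives a transitive subtournament of
-- order m in the Paley digraph (ramsey⇒paley), contradicting 𝒦 m = 0.

import Algebra.Properties.AbelianGroup as AbelianGroupProperties
import Algebra.Properties.CommutativeMonoid.Sum as Sum
import Algebra.Properties.CommutativeSemiring.Exp as CommExp
import Algebra.Properties.Monoid.Mult as Mult
import Algebra.Properties.Ring as RingProperties
import Algebra.Properties.Semiring.Exp as Exp
open import Data.Fin.Base as Fin using (Fin; punchIn; punchOut; inject≤)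
open import Data.Fin.Permutation as Perm using (Permutation′; _⟨$⟩ʳ_)
open import Data.Fin.Properties
  using (any?; punchInᵢ≢i; punchIn-injective; punchIn-punchOut; inject≤-injective; ¬Fin0)
open import Data.Fin.Subset using (Subset; inside; outside; ⁅_⁆; _∪_; ⊥)
  renaming (_∈_ to _∈ₛ_)
open import Data.Fin.Subset.Properties using (x∈⁅x⁆; x∈⁅y⁆⇒x≡y; x∈p∪q⁻; x∈p∪q⁺; ∉⊥)
open import Data.List.Base as List
  using (List; []; _∷_; _++_; length; filter; map; allFin; cartesianProduct; tabulate)
open import Data.List.Membership.Propositional using (_∈_; find; lose)
open import Data.List.Membership.Propositional.Properties
  using (∈-lookup; ∈-cartesianProduct⁻; ∈-map⁺; ∈-++⁺ˡ; ∈-++⁺ʳ)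
open import Data.List.Properties
  using (length-map; length-++; length-tabulate; length-replicate; filter-some)
open import Data.List.Relation.Unary.All as All using (All; []; _∷_)
import Data.List.Relation.Unary.All.Properties as All
open import Data.List.Relation.Unary.AllPairs as AllPairs using (AllPairs; []; _∷_)
import Data.List.Relation.Unary.AllPairs.Properties as AllPairs
open import Data.List.Relation.Unary.Any as Any using (Any; here; there)
import Data.List.Relation.Unary.Any.Properties as Any
open import Data.List.Relation.Unary.Unique.Propositional.Properties using (allFin⁺)
open import Data.Maybe.Base using (nothing)
open import Data.Nat using (ℕ; zero; suc; _+_; _*_; _∸_; _≤_; _<_; z≤n; s≤s; >-nonZero)
open import Data.Nat.DivMod using (_/_)
open import Data.Nat.Divisibility using (_∣_; divides; ∣⇒≤; n/m≡quotient)
import Data.Nat.Properties as ℕ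
open import Data.Product using (∃-syntax; ∃₂; _×_; _,_; proj₁; proj₂)
open import Data.Sum as Sum⊎ using (_⊎_; inj₁; inj₂)
open import Data.Vec as Vec using (Vec; []; _∷_; replicate)
import Data.Vec.Membership.Propositional as Vec using (_∈_)
import Data.Vec.Membership.Propositional.Properties as Vec using (∈-lookup)
import Data.Vec.Properties as Vec using (lookup-replicate)
import Data.Vec.Relation.Unary.All as VecAll
import Data.Vec.Relation.Unary.All.Properties as VecAll using (lookup⁻)
import Data.Vec.Relation.Unary.AllPairs as VecAllPairs
import Data.Vec.Relation.Unary.AllPairs.Properties as VecAllPairs
import Data.Vec.Relation.Unary.Any as VecAny
open import Function using (_∘_; id; Inverse; Equivalence; mk⇔)
open import Level using (Level; 0ℓ; _⊔_)
open import Relation.Binary using (Rel; REL; Decidable)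
open import Relation.Binary.PropositionalEquality as ≡ using (_≡_; _≢_)
open import Relation.Nullary using (¬_; Dec; yes; no; contradiction; ¬?)
open import Relation.Nullary.Decidable
  using (_⊎-dec_; _×-dec_; isYes; T?; True; toWitness; fromWitness)
import Relation.Unary as U
open import Tactic.RingSolver.Core.AlmostCommutativeRing using (fromCommutativeRing)
import Tactic.RingSolver.NonReflective as Solver
open import Defs

private variable
  a p ℓ ℓ₂ : Level
  A B : Set a

-- Lists: counting and transversals

length-filter-¬ : {P : A → Set p} (P? : U.Decidable P) → ∀ xs →
                  length xs ≡ length (filter P? xs) + length (filter (¬? ∘ P?) xs)
length-filter-¬ P? []       = ≡.refl
length-filter-¬ P? (x ∷ xs) with P? x
... | yes _ = ≡.cong suc (length-filter-¬ P? xs)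
... | no  _ = ≡.trans (≡.cong suc (length-filter-¬ P? xs)) (≡.sym (ℕ.+-suc _ _))

length-cartesianProduct : (xs : List A) (ys : List B) →
  length (cartesianProduct xs ys) ≡ length xs * length ys
length-cartesianProduct []       ys = ≡.refl
length-cartesianProduct (x ∷ xs) ys = ≡.trans (length-++ (map (x ,_) ys))
  (≡.cong₂ _+_ (length-map (x ,_) ys) (length-cartesianProduct xs ys))

allPairs-∩ : {P : A → Set p} {R : Rel A ℓ₂} {xs : List A} → All P xs → AllPairs R xs →
             AllPairs (λ x y → P x × P y × R x y) xs
allPairs-∩ []         []         = []
allPairs-∩ (px ∷ pxs) (rx ∷ rxs) =
  All.zipWith (λ (py , rxy) → px , py , rxy) (pxs , rx) ∷ allPairs-∩ pxs rxs

allPairs⇒related : {R : Rel A ℓ₂} {xs : List A} →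
  (∀ {x} → x ∈ xs → R x x) → (∀ {x y} → R x y → R y x) → AllPairs R xs →
  ∀ {x y} → x ∈ xs → y ∈ xs → R x y
allPairs⇒related rfl sm (rx ∷ rxs) (here ≡.refl) (here ≡.refl) = rfl (here ≡.refl)
allPairs⇒related rfl sm (rx ∷ rxs) (here ≡.refl) (there j)     = All.lookup rx j
allPairs⇒related rfl sm (rx ∷ rxs) (there i)     (here ≡.refl) = sm (All.lookup rx i)
allPairs⇒related rfl sm (rx ∷ rxs) (there i)     (there j)     =
  allPairs⇒related (rfl ∘ there) sm rxs i j

-- A list of D-distinct elements, each related to some entry of ys, has at most
-- k entries per entry of ys if D-distinct elements related to a common y number
-- at most k.
pigeonhole : {D : Rel A p} {R : REL A B ℓ₂} (R? : Decidable R) {k : ℕ} →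
  (∀ y {zs} → AllPairs D zs → All (λ z → R z y) zs → length zs ≤ k) →
  ∀ ys {xs} → AllPairs D xs → All (λ x → Any (R x) ys) xs → length xs ≤ length ys * k
pigeonhole R? fibre []       dxs []       = z≤n
pigeonhole {R = R} R? {k} fibre (y ∷ ys) {xs} dxs hits = begin
  length xs                                 ≡⟨ length-filter-¬ Q? xs ⟩
  length (filter Q? xs) + length (filter (¬? ∘ Q?) xs)
    ≤⟨ ℕ.+-mono-≤ (fibre y (AllPairs.filter⁺ Q? dxs) (All.all-filter Q? xs))
                  (pigeonhole R? fibre ys (AllPairs.filter⁺ (¬? ∘ Q?) dxs) rest) ⟩
  k + length ys * k                         ∎
  where
  open ℕ.≤-Reasoning
  Q? = λ x → R? x y
  rest : All (λ x → Any (R x) ys) (filter (¬? ∘ Q?) xs)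
  rest = All.zipWith (λ { (¬q , any) → Any.tail ¬q any })
           (All.all-filter (¬? ∘ Q?) xs , All.filter⁺ (¬? ∘ Q?) hits)

-- Greedy choice.  R need not be transitive or symmetric.
transversal : {R : Rel A ℓ₂} → Decidable R → (∀ x → R x x) → ∀ xs →
  ∃[ ys ] (∀ {y} → y ∈ ys → y ∈ xs) × AllPairs (λ x y → ¬ R x y) ys ×
          All (λ x → Any (R x) ys) xs
transversal R? rfl []       = [] , id , [] , []
transversal R? rfl (x ∷ xs) with transversal R? rfl xs
... | ys , ys⊆xs , sep , cov with Any.any? (R? x) ys
...   | yes hit = ys , there ∘ ys⊆xs , sep , hit ∷ cov
...   | no miss = x ∷ ys , (λ { (here eq) → here eq ; (there i) → there (ys⊆xs i) }) ,
                  All.¬Any⇒All¬ ys miss ∷ sep , here (rfl x) ∷ All.map there cov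

-- Padding repeats an entry, so that it keeps the set of entries.
pad : {x : A} (xs : List A) → x ∈ xs → ∀ {n} → length xs ≤ n →
  ∃[ ys ] length ys ≡ n × (∀ {z} → z ∈ xs → z ∈ ys) × (∀ {z} → z ∈ ys → z ∈ xs)
pad {x = x} xs x∈xs {n} len≤n = xs ++ List.replicate (n ∸ length xs) x ,
  ≡.trans (length-++ xs)
    (≡.trans (≡.cong (length xs +_) (length-replicate (n ∸ length xs)))
             (ℕ.m+[n∸m]≡n len≤n)) ,
  ∈-++⁺ˡ ,
  All.lookup (All.++⁺ (All.tabulate id) (All.replicate⁺ (n ∸ length xs) x∈xs))

-- Field arithmetic and roots of monic polynomials

module FieldProperties {a ℓ q} (F : FiniteField a ℓ q) where
  open FiniteField F renaming (_*_ to _·_; _+_ to _⊕_)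
  open RingProperties ring using (x∙y⁻¹≈ε⇒x≈y)
  open import Relation.Binary.Reasoning.Setoid setoid
  module S = Solver (fromCommutativeRing commutativeRing (λ _ → nothing))
  open S using (solve; _⊜_) renaming (_⊕_ to _:+_; _⊗_ to _:*_)

  cancelˡ : ∀ {x y z} → ¬ (x ≈ 0#) → x · y ≈ x · z → y ≈ z
  cancelˡ {x} {y} {z} x≉0 eq = let x⁻¹ , xx⁻¹ = inverse x x≉0 in begin
    y               ≈⟨ *-identityˡ y ⟨
    1# · y          ≈⟨ *-congʳ (trans (*-comm _ _) xx⁻¹) ⟨
    (x⁻¹ · x) · y   ≈⟨ *-assoc _ _ _ ⟩
    x⁻¹ · (x · y)   ≈⟨ *-congˡ eq ⟩
    x⁻¹ · (x · z)   ≈⟨ *-assoc _ _ _ ⟨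
    (x⁻¹ · x) · z   ≈⟨ *-congʳ (trans (*-comm _ _) xx⁻¹) ⟩
    1# · z          ≈⟨ *-identityˡ z ⟩
    z               ∎

  ·-nonzero : ∀ {x y} → ¬ (x ≈ 0#) → ¬ (y ≈ 0#) → ¬ (x · y ≈ 0#)
  ·-nonzero {x} x≉0 y≉0 eq = y≉0 (cancelˡ x≉0 (trans eq (sym (zeroʳ x))))

  ^-nonzero : ∀ {x} → ¬ (x ≈ 0#) → ∀ n → ¬ (x ^ n ≈ 0#)
  ^-nonzero x≉0 zero    = 0≉1 ∘ sym
  ^-nonzero x≉0 (suc n) = ·-nonzero x≉0 (^-nonzero x≉0 n)

  -- The monic polynomial c₀ + c₁ x + … + c_{n-1} x^(n-1) + x^n with the given lower
  -- coefficients, evaluated by Horner's rule.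
  evalMonic : ∀ {n} → Vec Carrier n → Carrier → Carrier
  evalMonic []       x = 1#
  evalMonic (c ∷ cs) x = c ⊕ x · evalMonic cs x

  -- The quotient of a monic polynomial by X - α (synthetic division).
  quotient : ∀ {n} → Vec Carrier (suc n) → Carrier → Vec Carrier n
  quotient (c ∷ [])     α = []
  quotient (c ∷ d ∷ cs) α = evalMonic (d ∷ cs) α ∷ quotient (d ∷ cs) α

  -- δ stands for x - α; avoiding subtraction, both steps are semiring identities.
  evalMonic-quotient : ∀ {n} (cs : Vec Carrier (suc n)) {α δ x} → x ≈ α ⊕ δ →
    evalMonic cs x ≈ evalMonic cs α ⊕ δ · evalMonic (quotient cs α) x
  evalMonic-quotient (c ∷ []) {α} {δ} {x} x≈α+δ = begin
    c ⊕ x · 1#               ≈⟨ +-congˡ (*-congʳ x≈α+δ) ⟩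
    c ⊕ (α ⊕ δ) · 1#         ≈⟨ solve 4 (λ c α δ i →
        (c :+ (α :+ δ) :* i) ⊜ ((c :+ α :* i) :+ δ :* i)) refl c α δ 1# ⟩
    (c ⊕ α · 1#) ⊕ δ · 1#    ∎
  evalMonic-quotient (c ∷ d ∷ cs) {α} {δ} {x} x≈α+δ = begin
    c ⊕ x · E x                              ≈⟨ +-congˡ (*-congˡ (evalMonic-quotient (d ∷ cs) x≈α+δ)) ⟩
    c ⊕ x · (E α ⊕ δ · Q)                    ≈⟨ solve 5 (λ c x δ e q →
        (c :+ x :* (e :+ δ :* q)) ⊜ ((c :+ x :* e) :+ δ :* (x :* q))) refl c x δ (E α) Q ⟩
    (c ⊕ x · E α) ⊕ δ · (x · Q)              ≈⟨ +-congʳ (+-congˡ (*-congʳ x≈α+δ)) ⟩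
    (c ⊕ (α ⊕ δ) · E α) ⊕ δ · (x · Q)        ≈⟨ solve 5 (λ c α δ e p →
        ((c :+ (α :+ δ) :* e) :+ δ :* p) ⊜ ((c :+ α :* e) :+ δ :* (e :+ p))) refl c α δ (E α) (x · Q) ⟩
    (c ⊕ α · E α) ⊕ δ · (E α ⊕ x · Q)        ∎
    where
    E = evalMonic (d ∷ cs)
    Q = evalMonic (quotient (d ∷ cs) α) x

  roots-≤-degree : ∀ {n} (cs : Vec Carrier n) {xs} → AllPairs (λ x y → ¬ (x ≈ y)) xs →
    All (λ x → evalMonic cs x ≈ 0#) xs → length xs ≤ n
  roots-≤-degree cs       []            []             = z≤n
  roots-≤-degree []       (_ ∷ _)       (1≈0 ∷ _)      = contradiction (sym 1≈0) 0≉1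
  roots-≤-degree (c ∷ cs) (_∷_ {x = α} α≉xs distinct) (α-root ∷ roots) =
    s≤s (roots-≤-degree (quotient (c ∷ cs) α) distinct
          (All.zipWith (λ {x} (α≉x , x-root) → quotient-root x α≉x x-root) (α≉xs , roots)))
    where
    α+[x-α]≈x : ∀ x → x ≈ α ⊕ (x - α)
    α+[x-α]≈x x = begin
      x                ≈⟨ +-identityʳ x ⟨
      x ⊕ 0#           ≈⟨ +-congˡ (-‿inverseˡ α) ⟨
      x ⊕ (- α ⊕ α)    ≈⟨ +-assoc _ _ _ ⟨
      (x - α) ⊕ α      ≈⟨ +-comm _ _ ⟩
      α ⊕ (x - α)      ∎

    quotient-root : ∀ x → ¬ (α ≈ x) → evalMonic (c ∷ cs) x ≈ 0# →
                    evalMonic (quotient (c ∷ cs) α) x ≈ 0#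
    quotient-root x α≉x x-root =
      cancelˡ (λ x-α≈0 → α≉x (sym (x∙y⁻¹≈ε⇒x≈y x α x-α≈0))) (begin
        (x - α) · Q                      ≈⟨ +-identityˡ _ ⟨
        0# ⊕ (x - α) · Q                 ≈⟨ +-congʳ α-root ⟨
        evalMonic (c ∷ cs) α ⊕ (x - α) · Q ≈⟨ evalMonic-quotient (c ∷ cs) (α+[x-α]≈x x) ⟨
        evalMonic (c ∷ cs) x             ≈⟨ x-root ⟩
        0#                               ≈⟨ zeroʳ _ ⟨
        (x - α) · 0#                     ∎)
      where Q = evalMonic (quotient (c ∷ cs) α) x

  evalMonic-zeros : ∀ n x → evalMonic (replicate n 0#) x ≈ x ^ n
  evalMonic-zeros zero    x = refl
  evalMonic-zeros (suc n) x = trans (+-identityˡ _) (*-congˡ (evalMonic-zeros n x))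

  powers-≤ : ∀ n c {xs} → AllPairs (λ x y → ¬ (x ≈ y)) xs →
    All (λ x → x ^ suc n ≈ c) xs → length xs ≤ suc n
  powers-≤ n c distinct powers = roots-≤-degree (- c ∷ replicate n 0#) distinct
    (All.map (λ {x} xⁿ≈c → begin
      - c ⊕ x · evalMonic (replicate n 0#) x  ≈⟨ +-congˡ (*-congˡ (evalMonic-zeros n x)) ⟩
      - c ⊕ x ^ suc n                         ≈⟨ +-congˡ xⁿ≈c ⟩
      - c ⊕ c                                 ≈⟨ -‿inverseˡ c ⟩
      0#                                      ∎) powers)

-- Fermat's theorem and the characteristic

module NonzeroElements {a ℓ N} (F : FiniteField a ℓ (suc N)) where
  open FiniteField F renaming (_*_ to _·_; _+_ to _⊕_)
  open FieldProperties F
  open import Relation.Binary.Reasoning.Setoid setoid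
  open Mult +-monoid using () renaming (_×_ to _×ₙ_; ×-congʳ to ×ₙ-congʳ; ×-assocˡ to ×ₙ-assocˡ)
  -- Sums and products of finite families; Π.sum is the product.
  module Σ = Sum +-commutativeMonoid
  module Π = Sum *-commutativeMonoid

  element-index : ∀ x → element (index x) ≈ x
  element-index = Inverse.strictlyInverseˡ enumeration

  index-element : ∀ i → index (element i) ≡ i
  index-element = Inverse.strictlyInverseʳ enumeration

  index-cong : ∀ {x y} → x ≈ y → index x ≡ index y
  index-cong = Inverse.from-cong enumeration

  element-cong : ∀ {i j} → i ≡ j → element i ≈ element j
  element-cong = Inverse.to-cong enumeration

  element-injective : ∀ {i j} → element i ≈ element j → i ≡ j
  element-injective {i} {j} eq =
    ≡.trans (≡.sym (index-element i)) (≡.trans (index-cong eq) (index-element j))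

  -- The N nonzero field elements, enumerated by skipping the index of zero;
  -- the field has N + 1 elements.
  unit : Fin N → Carrier
  unit j = element (punchIn (index 0#) j)

  unit-nonzero : ∀ j → ¬ (unit j ≈ 0#)
  unit-nonzero j eq =
    punchInᵢ≢i (index 0#) j (≡.trans (≡.sym (index-element _)) (index-cong eq))

  unit-injective : ∀ {i j} → unit i ≈ unit j → i ≡ j
  unit-injective eq = punchIn-injective (index 0#) _ _ (element-injective eq)

  unit-surjective : ∀ {x} → ¬ (x ≈ 0#) → ∃[ j ] unit j ≈ x
  unit-surjective {x} x≉0 = punchOut index≢ ,
    trans (element-cong (punchIn-punchOut index≢)) (element-index x)
    where
    index≢ : index 0# ≢ index x
    index≢ eq = x≉0 (trans (sym (element-index x)) (trans (element-cong (≡.sym eq)) (element-index 0#)))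

  -- The permutation of indices induced by a permutation f of the field with inverse g.
  permute : (f g : Carrier → Carrier) → (∀ {x y} → x ≈ y → f x ≈ f y) →
    (∀ {x y} → x ≈ y → g x ≈ g y) → (∀ x → f (g x) ≈ x) → (∀ x → g (f x) ≈ x) →
    Permutation′ (suc N)
  permute f g f-cong g-cong fg gf = Perm.permutation
    (λ i → index (f (element i))) (λ i → index (g (element i)))
    (λ i → ≡.trans (index-cong (trans (f-cong (element-index _)) (fg _))) (index-element i))
    (λ i → ≡.trans (index-cong (trans (g-cong (element-index _)) (gf _))) (index-element i))

  product-nonzero : ∀ {n} (f : Fin n → Carrier) → (∀ i → ¬ (f i ≈ 0#)) → ¬ (Π.sum f ≈ 0#)
  product-nonzero {zero}  f f≉0 = 0≉1 ∘ sym
  product-nonzero {suc n} f f≉0 = ·-nonzero (f≉0 Fin.zero) (product-nonzero (f ∘ Fin.suc) (f≉0 ∘ Fin.suc))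

  -- Multiplication by x permutes the nonzero elements, so it fixes their product.
  fermat : ∀ {x} → ¬ (x ≈ 0#) → x ^ N ≈ 1#
  fermat {x} x≉0 = cancelˡ (product-nonzero unit unit-nonzero) (begin
    Π.sum unit · x ^ N                           ≈⟨ *-comm _ _ ⟩
    x ^ N · Π.sum unit                           ≈⟨ *-congʳ (Π.sum-replicate N) ⟨
    Π.sum {N} (λ _ → x) · Π.sum unit             ≈⟨ Π.∑-distrib-+ (λ _ → x) unit ⟨
    Π.sum (λ j → x · unit j)                     ≈⟨ Π.sum-cong-≋ σ-scales ⟨
    Π.sum (λ j → unit (σ ⟨$⟩ʳ j))                ≈⟨ Π.sum-permute unit σ ⟨
    Π.sum unit                                   ≈⟨ *-identityʳ _ ⟨
    Π.sum unit · 1#                              ∎)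
    where
    x⁻¹ = proj₁ (inverse x x≉0)

    cancel : ∀ {u v} → u · v ≈ 1# → ∀ y → u · (v · y) ≈ y
    cancel uv≈1 y = trans (sym (*-assoc _ _ _)) (trans (*-congʳ uv≈1) (*-identityˡ y))

    π : Permutation′ (suc N)
    π = permute (x ·_) (x⁻¹ ·_) *-congˡ *-congˡ
      (cancel (proj₂ (inverse x x≉0))) (cancel (trans (*-comm _ _) (proj₂ (inverse x x≉0))))

    π-fixes-0 : π ⟨$⟩ʳ index 0# ≡ index 0#
    π-fixes-0 = index-cong (trans (*-congˡ (element-index 0#)) (zeroʳ x))

    σ : Permutation′ N
    σ = Perm.remove (index 0#) π

    σ-scales : ∀ j → unit (σ ⟨$⟩ʳ j) ≈ x · unit j
    σ-scales j = begin
      element (punchIn (index 0#) (σ ⟨$⟩ʳ j))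
        ≡⟨ ≡.cong (λ i → element (punchIn i (σ ⟨$⟩ʳ j))) π-fixes-0 ⟨
      element (punchIn (π ⟨$⟩ʳ index 0#) (σ ⟨$⟩ʳ j))
        ≡⟨ ≡.cong element (Perm.punchIn-permute π (index 0#) j) ⟨
      element (π ⟨$⟩ʳ punchIn (index 0#) j)
        ≈⟨ element-index _ ⟩
      x · unit j ∎

  -- Translation by 1 permutes the field, so it fixes the sum of all elements.
  size×1≈0 : suc N ×ₙ 1# ≈ 0#
  size×1≈0 = begin
    suc N ×ₙ 1#                                   ≈⟨ Σ.sum-replicate (suc N) ⟨
    Σ.sum ones                                    ≈⟨ +-identityʳ _ ⟨
    Σ.sum ones ⊕ 0#                               ≈⟨ +-congˡ (-‿inverseʳ _) ⟨
    Σ.sum ones ⊕ (Σ.sum element - Σ.sum element)  ≈⟨ +-assoc _ _ _ ⟨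
    (Σ.sum ones ⊕ Σ.sum element) - Σ.sum element  ≈⟨ +-congʳ (Σ.∑-distrib-+ ones element) ⟨
    Σ.sum (λ i → 1# ⊕ element i) - Σ.sum element
      ≈⟨ +-congʳ (Σ.sum-cong-≋ (λ i → element-index (1# ⊕ element i))) ⟨
    Σ.sum (λ i → element (τ ⟨$⟩ʳ i)) - Σ.sum element  ≈⟨ +-congʳ (Σ.sum-permute element τ) ⟨
    Σ.sum element - Σ.sum element                 ≈⟨ -‿inverseʳ _ ⟩
    0#                                            ∎
    where
    ones : Fin (suc N) → Carrier
    ones _ = 1#

    cancel : ∀ {u v} → u ⊕ v ≈ 0# → ∀ y → u ⊕ (v ⊕ y) ≈ y
    cancel u+v≈0 y = trans (sym (+-assoc _ _ _)) (trans (+-congʳ u+v≈0) (+-identityˡ y))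

    τ : Permutation′ (suc N)
    τ = permute (1# ⊕_) (- 1# ⊕_) +-congˡ +-congˡ (cancel (-‿inverseʳ 1#)) (cancel (-‿inverseˡ 1#))

  -- If 1 = -1, then the even number N acts as zero, so (N + 1) · 1 = 1.
  1≉-1 : 2 ∣ N → ¬ (1# ≈ - 1#)
  1≉-1 (divides c N≡c*2) 1≈-1 = 0≉1 (sym (begin
    1#                     ≈⟨ +-identityʳ 1# ⟨
    1# ⊕ 0#                ≈⟨ +-congˡ N×1≈0 ⟨
    suc N ×ₙ 1#            ≈⟨ size×1≈0 ⟩
    0#                     ∎))
    where
    2×1≈0 : 2 ×ₙ 1# ≈ 0#
    2×1≈0 = trans (+-congˡ (+-identityʳ 1#)) (trans (+-congʳ 1≈-1) (-‿inverseˡ 1#))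

    N×1≈0 : N ×ₙ 1# ≈ 0#
    N×1≈0 = begin
      N ×ₙ 1#            ≡⟨ ≡.cong (_×ₙ 1#) N≡c*2 ⟩
      (c * 2) ×ₙ 1#      ≈⟨ ×ₙ-assocˡ 1# c 2 ⟨
      c ×ₙ (2 ×ₙ 1#)     ≈⟨ ×ₙ-congʳ c 2×1≈0 ⟩
      c ×ₙ 0#            ≈⟨ Σ.sum-replicate c ⟨
      Σ.sum {c} (λ _ → 0#)  ≈⟨ Σ.sum-replicate-zero c ⟩
      0#                 ∎

-- Cosets of the group of k-th powers

module PowerClasses {a ℓ N} (k′ : ℕ) (F : FiniteField a ℓ (suc N)) where
  open FiniteField F renaming (_*_ to _·_; _+_ to _⊕_)
  open FieldProperties F
  open NonzeroElements F
  open RingProperties ring using (-‿distribˡ-*; -‿distribʳ-*; -‿involutive)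
  open CommExp commutativeSemiring using (^-distrib-*)
  open Exp semiring using (^-congˡ; ^-congʳ; ^-assocʳ)
  open import Relation.Binary.Reasoning.Setoid setoid

  k : ℕ
  k = suc k′

  -- x ~ y means that x is y times a nonzero k-th power.
  -- Writing the factor as a fraction makes symmetry immediate, and indexing by
  -- Fin N makes the relation decidable by search.
  infix 4 _~_
  _~_ : Rel Carrier ℓ
  x ~ y = ∃₂ λ i j → x · unit i ^ k ≈ y · unit j ^ k

  _~?_ : Decidable _~_
  x ~? y = any? (λ i → any? (λ j → (x · unit i ^ k) ≈? (y · unit j ^ k)))

  ~-intro : ∀ {x y u v} → ¬ (u ≈ 0#) → ¬ (v ≈ 0#) → x · u ^ k ≈ y · v ^ k → x ~ y
  ~-intro {x} {y} {u} {v} u≉0 v≉0 eq =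
    let i , uᵢ≈u = unit-surjective u≉0 ; j , uⱼ≈v = unit-surjective v≉0 in
    i , j , trans (*-congˡ (^-congˡ k uᵢ≈u)) (trans eq (*-congˡ (^-congˡ k (sym uⱼ≈v))))

  ~-refl : ∀ {x} → x ~ x
  ~-refl = ~-intro (0≉1 ∘ sym) (0≉1 ∘ sym) refl

  ~-sym : ∀ {x y} → x ~ y → y ~ x
  ~-sym (i , j , eq) = j , i , sym eq

  ~-trans : ∀ {x y z} → x ~ y → y ~ z → x ~ z
  ~-trans {x} {y} {z} (i , j , eq) (i′ , j′ , eq′) = ~-intro
    (·-nonzero (unit-nonzero i) (unit-nonzero i′))
    (·-nonzero (unit-nonzero j′) (unit-nonzero j)) (begin
      x · (unit i · unit i′) ^ k         ≈⟨ split x _ _ ⟩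
      x · unit i ^ k · unit i′ ^ k       ≈⟨ *-congʳ eq ⟩
      y · unit j ^ k · unit i′ ^ k       ≈⟨ *-assoc _ _ _ ⟩
      y · (unit j ^ k · unit i′ ^ k)     ≈⟨ *-congˡ (*-comm _ _) ⟩
      y · (unit i′ ^ k · unit j ^ k)     ≈⟨ *-assoc _ _ _ ⟨
      y · unit i′ ^ k · unit j ^ k       ≈⟨ *-congʳ eq′ ⟩
      z · unit j′ ^ k · unit j ^ k       ≈⟨ split z _ _ ⟨
      z · (unit j′ · unit j) ^ k         ∎)
    where
    split : ∀ w u v → w · (u · v) ^ k ≈ w · u ^ k · v ^ k
    split w u v = trans (*-congˡ (^-distrib-* u v k)) (sym (*-assoc _ _ _))

  ≈⇒~ : ∀ {x y} → x ≈ y → x ~ y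
  ≈⇒~ x≈y = ~-intro (0≉1 ∘ sym) (0≉1 ∘ sym) (*-congʳ x≈y)

  ~-neg : ∀ {x y} → x ~ y → - x ~ - y
  ~-neg (i , j , eq) = i , j , trans (sym (-‿distribˡ-* _ _)) (trans (-‿cong eq) (-‿distribˡ-* _ _))

  ~-negˡ : ∀ {x y} → - x ~ y → x ~ - y
  ~-negˡ {x} -x~y = ~-trans (≈⇒~ (sym (-‿involutive x))) (~-neg -x~y)

  ~-nonzero : ∀ {x y} → x ~ y → ¬ (y ≈ 0#) → ¬ (x ≈ 0#)
  ~-nonzero {x} {y} (i , j , eq) y≉0 x≈0 = ·-nonzero y≉0 (^-nonzero (unit-nonzero j) k)
    (trans (sym eq) (trans (*-congʳ x≈0) (zeroˡ _)))

  ~⇒nonzeroPower : ∀ {x y y⁻¹} → ¬ (y ≈ 0#) → y · y⁻¹ ≈ 1# → x ~ y → NonzeroPower k (y⁻¹ · x)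
  ~⇒nonzeroPower {x} {y} {y⁻¹} y≉0 yy⁻¹≈1 x~y@(i , j , eq) =
    ·-nonzero y⁻¹≉0 (~-nonzero x~y y≉0) , v · u⁻¹ , (begin
      (v · u⁻¹) ^ k                        ≈⟨ ^-distrib-* v u⁻¹ k ⟩
      v ^ k · u⁻¹ ^ k                      ≈⟨ *-congʳ (*-identityˡ _) ⟨
      (1# · v ^ k) · u⁻¹ ^ k               ≈⟨ *-congʳ (*-congʳ (trans (*-comm _ _) yy⁻¹≈1)) ⟨
      ((y⁻¹ · y) · v ^ k) · u⁻¹ ^ k        ≈⟨ *-congʳ (*-assoc _ _ _) ⟩
      (y⁻¹ · (y · v ^ k)) · u⁻¹ ^ k        ≈⟨ *-congʳ (*-congˡ eq) ⟨
      (y⁻¹ · (x · u ^ k)) · u⁻¹ ^ k        ≈⟨ *-congʳ (*-assoc _ _ _) ⟨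
      ((y⁻¹ · x) · u ^ k) · u⁻¹ ^ k        ≈⟨ *-assoc _ _ _ ⟩
      (y⁻¹ · x) · (u ^ k · u⁻¹ ^ k)        ≈⟨ *-congˡ (^-distrib-* u u⁻¹ k) ⟨
      (y⁻¹ · x) · (u · u⁻¹) ^ k            ≈⟨ *-congˡ (^-congˡ k uu⁻¹≈1) ⟩
      (y⁻¹ · x) · 1# ^ k                   ≈⟨ *-congˡ (1^ k) ⟩
      (y⁻¹ · x) · 1#                       ≈⟨ *-identityʳ _ ⟩
      y⁻¹ · x                              ∎)
    where
    u = unit i
    v = unit j
    u⁻¹ = proj₁ (inverse u (unit-nonzero i))
    uu⁻¹≈1 = proj₂ (inverse u (unit-nonzero i))

    y⁻¹≉0 : ¬ (y⁻¹ ≈ 0#)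
    y⁻¹≉0 y⁻¹≈0 = 0≉1 (trans (sym (zeroʳ y)) (trans (*-congˡ (sym y⁻¹≈0)) yy⁻¹≈1))

    1^ : ∀ n → 1# ^ n ≈ 1#
    1^ zero    = refl
    1^ (suc n) = trans (*-identityˡ _) (1^ n)

  neg-odd-^ : ∀ x n → (- x) ^ suc (2 * n) ≈ - (x ^ suc (2 * n))
  neg-odd-^ x n = begin
    - x · (- x) ^ (2 * n)       ≈⟨ *-congˡ (^-assocʳ (- x) 2 n) ⟨
    - x · ((- x) ^ 2) ^ n       ≈⟨ *-congˡ (^-congˡ n neg-square) ⟩
    - x · (x ^ 2) ^ n           ≈⟨ *-congˡ (^-assocʳ x 2 n) ⟩
    - x · x ^ (2 * n)           ≈⟨ -‿distribˡ-* _ _ ⟨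
    - (x · x ^ (2 * n))         ∎
    where
    neg-square : (- x) ^ 2 ≈ x ^ 2
    neg-square = begin
      - x · (- x · 1#)      ≈⟨ -‿distribˡ-* _ _ ⟨
      - (x · (- x · 1#))    ≈⟨ -‿cong (*-congˡ (-‿distribˡ-* _ _)) ⟨
      - (x · - (x · 1#))    ≈⟨ -‿cong (-‿distribʳ-* _ _) ⟨
      - - (x · (x · 1#))    ≈⟨ -‿involutive _ ⟩
      x · (x · 1#)          ∎

  -- In effect, -1 is not a k-th power.
  x≁-x : ∀ {n} → 2 ∣ k → N ≡ k * suc (2 * n) → ∀ {x} → ¬ (x ≈ 0#) → ¬ (x ~ - x)
  x≁-x {n} (divides c k≡c*2) N≡kd {x} x≉0 (i , j , eq) =
    1≉-1 (divides (c * d) N≡cd*2) (begin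
      1#                      ≈⟨ ^k^d≈1 i ⟨
      (unit i ^ k) ^ d        ≈⟨ ^-congˡ d (cancelˡ x≉0 (trans eq
                                    (trans (sym (-‿distribˡ-* _ _)) (-‿distribʳ-* _ _)))) ⟩
      (- (unit j ^ k)) ^ d    ≈⟨ neg-odd-^ (unit j ^ k) n ⟩
      - ((unit j ^ k) ^ d)    ≈⟨ -‿cong (^k^d≈1 j) ⟩
      - 1#                    ∎)
    where
    d : ℕ
    d = suc (2 * n)

    N≡cd*2 : N ≡ (c * d) * 2
    N≡cd*2 = ≡.trans N≡kd (≡.trans (≡.cong (_* d) k≡c*2)
      (≡.trans (ℕ.*-assoc c 2 d) (≡.trans (≡.cong (c *_) (ℕ.*-comm 2 d)) (≡.sym (ℕ.*-assoc c d 2)))))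

    ^k^d≈1 : ∀ i → (unit i ^ k) ^ d ≈ 1#
    ^k^d≈1 i = trans (^-assocʳ (unit i) k d)
      (trans (^-congʳ (unit i) (≡.sym N≡kd)) (fermat (unit-nonzero i)))

-- Counting the cosets and choosing representatives

module PowerClassCount {a ℓ N} (k′ : ℕ) (F : FiniteField a ℓ (suc N)) where
  open FiniteField F renaming (_*_ to _·_; _+_ to _⊕_)
  open FieldProperties F
  open NonzeroElements F
  open PowerClasses k′ F
  open RingProperties ring using (-‿involutive; -0#≈0#)

  classes-≤-k : 1 ≤ N → ∀ {rs} → (∀ {r} → r ∈ rs → ¬ (r ≈ 0#)) →
                AllPairs (λ x y → ¬ (x ~ y)) rs → length rs ≤ k
  classes-≤-k 1≤N {rs} rs≉0 distinct = ℕ.*-cancelʳ-≤ (length rs) k N ⦃ >-nonZero 1≤N ⦄ (begin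
    length rs * N                            ≡⟨ ≡.cong (length rs *_) (length-tabulate {n = N} id) ⟨
    length rs * length (allFin N)            ≡⟨ length-cartesianProduct rs (allFin N) ⟨
    length (cartesianProduct rs (allFin N))  ≤⟨ pigeonhole hits? fibre (tabulate unit)
                                                 (apart distinct) (All.tabulate hit) ⟩
    length (tabulate unit) * k               ≡⟨ ≡.cong (_* k) (length-tabulate unit) ⟩
    N * k                                    ≡⟨ ℕ.*-comm N k ⟩
    k * N                                    ∎)
    where
    open ℕ.≤-Reasoning

    -- The pair (r , i) hits y when r · (unit i)ᵏ = y; a pair with r = 0 hits nothing,
    -- so that r can be cancelled in a fibre.
    Hits : REL (Carrier × Fin N) Carrier ℓ
    Hits (r , i) y = ¬ (r ≈ 0#) × r · unit i ^ k ≈ y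

    hits? : Decidable Hits
    hits? (r , i) y = ¬? (r ≈? 0#) ×-dec ((r · unit i ^ k) ≈? y)

    -- Two pairs of a common fibre that are apart agree in r, and differ in the unit.
    Apart : Rel (Carrier × Fin N) _
    Apart (r , i) (s , j) = ¬ (r ~ s) ⊎ (r ≡ s × i ≢ j)

    apart : ∀ {rs} → AllPairs (λ x y → ¬ (x ~ y)) rs → AllPairs Apart (cartesianProduct rs (allFin N))
    apart []                                   = []
    apart {rs = r ∷ rs} (r≁rs ∷ distinct) = AllPairs.++⁺
      (AllPairs.map⁺ (AllPairs.map (λ i≢j → inj₂ (≡.refl , i≢j)) (allFin⁺ N)))
      (apart distinct)
      (All.map⁺ (All.universal (λ i → All.tabulate (λ s,j∈ →
        inj₁ (All.lookup r≁rs (proj₁ (∈-cartesianProduct⁻ rs (allFin N) s,j∈))))) (allFin N)))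

    hit : ∀ {z} → z ∈ cartesianProduct rs (allFin N) → Any (Hits z) (tabulate unit)
    hit {r , i} z∈ =
      let r∈rs , _ = ∈-cartesianProduct⁻ rs (allFin N) z∈
          j , uⱼ≈  = unit-surjective (·-nonzero (rs≉0 r∈rs) (^-nonzero (unit-nonzero i) k))
      in Any.tabulate⁺ j (rs≉0 r∈rs , sym uⱼ≈)

    same : ∀ {y z w} → Hits z y × Hits w y × Apart z w →
           proj₁ z ≡ proj₁ w × ¬ (unit (proj₂ z) ≈ unit (proj₂ w))
    same {z = _ , i} {_ , j} ((_ , hz) , (_ , hw) , inj₁ r≁s) =
      contradiction (i , j , trans hz (sym hw)) r≁s
    same (_ , _ , inj₂ (r≡s , i≢j)) = r≡s , i≢j ∘ unit-injective

    fibre : ∀ y {zs} → AllPairs Apart zs → All (λ z → Hits z y) zs → length zs ≤ k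
    fibre y {[]}                  _      _  = z≤n
    fibre y {zs@((r , i) ∷ _)} apart hits@((r≉0 , rxᵏ≈y) ∷ hits′)
      with AllPairs.map same (allPairs-∩ hits apart)
    ... | pairs@(first ∷ _) = ≡.subst (_≤ k) (length-map (unit ∘ proj₂) zs)
      (powers-≤ k′ (unit i ^ k) (AllPairs.map⁺ (AllPairs.map proj₂ pairs))
        (refl ∷ All.map⁺ (All.zipWith (λ { ((≡.refl , _) , (_ , h)) →
            cancelˡ r≉0 (trans h (sym rxᵏ≈y)) }) (first , hits′))))

  -- A list rs whose entries represent all the cosets up to sign, such that the
  -- cosets of rs and of the negatives of rs are disjoint.  Repeated entries are
  -- permitted, which leaves the length of the list free.
  record Representatives (rs : List Carrier) : Set (a ⊔ ℓ) where
    field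
      nonzero   : ∀ {r} → r ∈ rs → ¬ (r ≈ 0#)
      covers    : ∀ {x} → ¬ (x ≈ 0#) → Any (λ r → x ~ r ⊎ x ~ - r) rs
      separated : ∀ {r s} → r ∈ rs → s ∈ rs → ¬ (r ~ - s)

  -- A transversal for equivalence up to sign, together with its negatives, consists
  -- of pairwise inequivalent elements; hence the bound k on its doubled length.
  representatives : ∀ {c n} → k ≡ c * 2 → N ≡ k * suc (2 * n) →
                    ∃[ rs ] length rs ≡ c × Representatives rs
  representatives {c} {n} k≡c*2 N≡kd
    with transversal (λ x y → (x ~? y) ⊎-dec (x ~? (- y))) (λ _ → inj₁ ~-refl) (tabulate unit)
  ... | rs , rs⊆units , distinct , hits = padded
    where
    nonzero : ∀ {r} → r ∈ rs → ¬ (r ≈ 0#)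
    nonzero = All.lookup (All.tabulate⁺ unit-nonzero) ∘ rs⊆units

    covers : ∀ {x} → ¬ (x ≈ 0#) → Any (λ r → x ~ r ⊎ x ~ - r) rs
    covers x≉0 = let j , uⱼ≈x = unit-surjective x≉0 ; x~uⱼ = ≈⇒~ (sym uⱼ≈x) in
      Any.map (Sum⊎.map (~-trans x~uⱼ) (~-trans x~uⱼ)) (All.tabulate⁻ hits j)

    separated : ∀ {r s} → r ∈ rs → s ∈ rs → ¬ (r ~ - s)
    separated = allPairs⇒related {R = λ x y → ¬ (x ~ - y)}
      (λ r∈rs → x≁-x {n} (divides c k≡c*2) N≡kd (nonzero r∈rs))
      (λ x≁-y y~-x → x≁-y (~-negˡ (~-sym y~-x)))
      (AllPairs.map (_∘ inj₂) distinct)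

    -x~-y⇒x~y : ∀ {x y} → - x ~ - y → x ~ y
    -x~-y⇒x~y {y = y} -x~-y = ~-trans (~-negˡ -x~-y) (≈⇒~ (-‿involutive y))

    signed-distinct : AllPairs (λ x y → ¬ (x ~ y)) (rs ++ map -_ rs)
    signed-distinct = AllPairs.++⁺
      (AllPairs.map (_∘ inj₁) distinct)
      (AllPairs.map⁺ (AllPairs.map (λ ¬R -x~-y → ¬R (inj₁ (-x~-y⇒x~y -x~-y))) distinct))
      (All.tabulate (λ r∈rs → All.map⁺ (All.tabulate (λ s∈rs → separated r∈rs s∈rs))))

    signed-nonzero : ∀ {r} → r ∈ rs ++ map -_ rs → ¬ (r ≈ 0#)
    signed-nonzero = All.lookup (All.++⁺ (All.tabulate nonzero)
      (All.map⁺ (All.tabulate (λ r∈rs -r≈0 →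
        nonzero r∈rs (trans (sym (-‿involutive _)) (trans (-‿cong -r≈0) -0#≈0#))))))

    length≤c : length rs ≤ c
    length≤c = ℕ.*-cancelʳ-≤ (length rs) c 2 (begin
      length rs * 2                     ≡⟨ ℕ.*-comm (length rs) 2 ⟩
      length rs + (length rs + 0)       ≡⟨ ≡.cong (length rs +_) (ℕ.+-identityʳ _) ⟩
      length rs + length rs             ≡⟨ ≡.cong (length rs +_) (length-map -_ rs) ⟨
      length rs + length (map -_ rs)    ≡⟨ length-++ rs ⟨
      length (rs ++ map -_ rs)          ≤⟨ classes-≤-k 1≤N signed-nonzero signed-distinct ⟩
      k                                 ≡⟨ k≡c*2 ⟩
      c * 2                             ∎)
      where
      open ℕ.≤-Reasoning
      1≤N : 1 ≤ N
      1≤N = ≡.subst (1 ≤_) (≡.sym N≡kd) (s≤s z≤n)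

    padded : ∃[ rs′ ] length rs′ ≡ c × Representatives rs′
    padded =
      let _ , r∈rs , _ = find (covers (0≉1 ∘ sym))
          rs′ , length≡c , rs⊆rs′ , rs′⊆rs = pad rs r∈rs length≤c
      in rs′ , length≡c , record
        { nonzero   = nonzero ∘ rs′⊆rs
        ; covers    = λ x≉0 → let _ , s∈rs , x~±s = find (covers x≉0) in
                              lose (rs⊆rs′ s∈rs) x~±s
        ; separated = λ r∈ s∈ → separated (rs′⊆rs r∈) (rs′⊆rs s∈)
        }

-- Subtournaments

vec-allPairs-∩ : ∀ {n} {P : A → Set p} {R : Rel A ℓ₂} {xs : Vec A n} →
  VecAll.All P xs → VecAllPairs.AllPairs R xs →
  VecAllPairs.AllPairs (λ x y → P x × P y × R x y) xs
vec-allPairs-∩ VecAll.[]           VecAllPairs.[]           = VecAllPairs.[]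
vec-allPairs-∩ (px VecAll.∷ pxs) (rx VecAllPairs.∷ rxs) =
  VecAll.map (λ (py , rxy) → px , py , rxy) (VecAll.zip (pxs , rx))
    VecAllPairs.∷ vec-allPairs-∩ pxs rxs

-- The set of entries of a vector.
fromVec : ∀ {n m} → Vec (Fin n) m → Subset n
fromVec []       = ⊥
fromVec (v ∷ vs) = ⁅ v ⁆ ∪ fromVec vs

∈-fromVec⁻ : ∀ {n m} (vs : Vec (Fin n) m) {v} → v ∈ₛ fromVec vs → v Vec.∈ vs
∈-fromVec⁻ []       v∈⊥ = contradiction v∈⊥ ∉⊥
∈-fromVec⁻ (u ∷ vs) v∈  with x∈p∪q⁻ ⁅ u ⁆ (fromVec vs) v∈
... | inj₁ v∈⁅u⁆ = VecAny.here (x∈⁅y⁆⇒x≡y u v∈⁅u⁆)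
... | inj₂ v∈vs  = VecAny.there (∈-fromVec⁻ vs v∈vs)

∈-fromVec⁺ : ∀ {n m} {vs : Vec (Fin n) m} {v} → v Vec.∈ vs → v ∈ₛ fromVec vs
∈-fromVec⁺ (VecAny.here ≡.refl) = x∈p∪q⁺ (inj₁ (x∈⁅x⁆ _))
∈-fromVec⁺ (VecAny.there v∈vs)  = x∈p∪q⁺ (inj₂ (∈-fromVec⁺ v∈vs))

∈-allSubsets : ∀ {n} (W : Subset n) → W ∈ allSubsets n
∈-allSubsets []            = here ≡.refl
∈-allSubsets (inside ∷ W)  = ∈-++⁺ˡ (∈-map⁺ (inside ∷_) (∈-allSubsets W))
∈-allSubsets {suc n} (outside ∷ W) =
  ∈-++⁺ʳ (map (inside ∷_) (allSubsets n)) (∈-map⁺ (outside ∷_) (∈-allSubsets W))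

𝒦>0 : ∀ {n m} (G : Digraph ℓ n) {W} → TransitiveSubtournament G m W → 0 < 𝒦 m G
𝒦>0 {m = m} G {W} t = filter-some (transitiveSubtournament? G m) (lose (∈-allSubsets W) t)

-- The coloured tournament

module PaleyColouring {a ℓ N} (k′ : ℕ) (F : FiniteField a ℓ (suc N)) where
  open FiniteField F renaming (_*_ to _·_; _+_ to _⊕_)
  open NonzeroElements F
  open PowerClasses k′ F
  open PowerClassCount k′ F
  open RingProperties ring using (x∙y⁻¹≈ε⇒x≈y; x[y-z]≈xy-xz)
  open AbelianGroupProperties +-abelianGroup using (⁻¹-anti-homo‿-)

  nonzeroPower-resp-≈ : ∀ {x y} → x ≈ y → NonzeroPower k x → NonzeroPower k y
  nonzeroPower-resp-≈ x≈y (x≉0 , z , zᵏ≈x) = x≉0 ∘ trans x≈y , z , trans zᵏ≈x x≈y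

  module _ {rs} (reps : Representatives rs) {n} (n≤q : n ≤ suc N) where
    open Representatives reps

    -- The field elements that serve as the n vertices.
    vertex : Fin n → Carrier
    vertex v = element (inject≤ v n≤q)

    vertex-injective : ∀ {u v} → vertex u ≈ vertex v → u ≡ v
    vertex-injective eq = inject≤-injective n≤q n≤q _ _ (element-injective eq)

    -- Membership in one of the cosets represented by rs: the possible differences
    -- along the edges of the tournament.
    Positive : Carrier → Set _
    Positive x = Any (x ~_) rs

    positive? : U.Decidable Positive
    positive? x = Any.any? (x ~?_) rs

    -- Truth of the decision, not the evidence itself, gives edges in Set.
    tournament : Digraph 0ℓ n
    tournament = record
      { _⟶_  = λ u v → True (positive? (vertex v - vertex u))
      ; _⟶?_ = λ u v → T? (isYes (positive? (vertex v - vertex u)))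
      }

    open Digraph tournament

    isTournament : IsTournament tournament
    isTournament = record
      { loopless  = λ v e → let _ , r∈rs , v-v~r = find (toWitness e) in
                    ~-nonzero v-v~r (nonzero r∈rs) (-‿inverseʳ (vertex v))
      ; connected = connected
      ; oriented  = λ u v (e , e′) →
          let _ , r∈rs , v-u~r = find (toWitness e)
              _ , s∈rs , u-v~s = find (toWitness e′)
          in separated r∈rs s∈rs (~-trans (~-sym v-u~r)
               (~-negˡ (~-trans (≈⇒~ (⁻¹-anti-homo‿- (vertex v) (vertex u))) u-v~s)))
      }
      where
      connected : ∀ u v → u ≢ v → u ⟶ v ⊎ v ⟶ u
      connected u v u≢v
        with find (covers (λ v-u≈0 →
          u≢v (≡.sym (vertex-injective (x∙y⁻¹≈ε⇒x≈y _ _ v-u≈0)))))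
      ... | _ , r∈rs , inj₁ v-u~r  = inj₁ (fromWitness (lose r∈rs v-u~r))
      ... | _ , r∈rs , inj₂ v-u~-r = inj₂ (fromWitness (lose r∈rs
        (~-trans (≈⇒~ (sym (⁻¹-anti-homo‿- (vertex v) (vertex u)))) (~-sym (~-negˡ (~-sym v-u~-r))))))

    -- The colour is read off the decision, since the evidence for an edge is
    -- irrelevant in a colouring.
    representative : ∀ {x} (d : Dec (Positive x)) → .(True d) → Fin (length rs)
    representative (yes p) _ = Any.index p

    ~-representative : ∀ {x} (d : Dec (Positive x)) (e : True d) →
                       x ~ List.lookup rs (representative d e)
    ~-representative (yes p) _ = Any.lookup-index p

    colouring : Colouring tournament (length rs)
    colouring u v e = representative (positive? (vertex v - vertex u)) e

    monochromatic⇒paley : ∀ {i m W} → TransitiveSubtournament tournament m W →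
      Monochromatic tournament colouring i W →
      ∃[ W′ ] TransitiveSubtournament (paleyDigraph k F) m W′
    monochromatic⇒paley {i} {m} {W} (vs , (_ , lists) , ordered) mono =
      fromVec ws , ws , (VecAllPairs.map distinct paley , (λ v → mk⇔ (∈-fromVec⁻ ws) ∈-fromVec⁺)) , paley
      where
      r   = List.lookup rs i
      r≉0 = nonzero (∈-lookup i)
      r⁻¹ = proj₁ (inverse r r≉0)

      scale : Fin n → Fin (suc N)
      scale v = index (r⁻¹ · vertex v)

      ws : Vec (Fin (suc N)) m
      ws = Vec.map scale vs

      scale-edge : ∀ {u v} → u ∈ₛ W × v ∈ₛ W × u ⟶ v →
                   NonzeroPower k (element (scale v) - element (scale u))
      scale-edge {u} {v} (u∈W , v∈W , e) = nonzeroPower-resp-≈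
        (trans (x[y-z]≈xy-xz _ _ _)
          (sym (+-cong (element-index _) (-‿cong (element-index _)))))
        (~⇒nonzeroPower r≉0 (proj₂ (inverse r r≉0))
          (≡.subst (λ j → (vertex v - vertex u) ~ List.lookup rs j) (mono u v u∈W v∈W e)
            (~-representative (positive? (vertex v - vertex u)) e)))

      -- Membership in W is what allows the common colour to be used on the edges of vs.
      paley : VecAllPairs.AllPairs (Digraph._⟶_ (paleyDigraph k F)) ws
      paley = VecAllPairs.map⁺ (VecAllPairs.map scale-edge
        (vec-allPairs-∩
          (VecAll.lookup⁻ (λ j → Equivalence.from (lists _) (Vec.∈-lookup j vs))) ordered))

      distinct : ∀ {u v} → NonzeroPower k (element v - element u) → u ≢ v
      distinct (v-u≉0 , _) ≡.refl = v-u≉0 (-‿inverseʳ _)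

    ramsey⇒paley : ∀ {m} → RamseyProperty (replicate (length rs) m) n →
                   ∃[ W ] TransitiveSubtournament (paleyDigraph k F) m W
    ramsey⇒paley {m} ramsey with ramsey tournament isTournament colouring
    ... | i , W , transitive , mono rewrite Vec.lookup-replicate i m =
      monochromatic⇒paley transitive mono

-- The congruence condition

N≡k*odd : ∀ k N → 1 ≤ k → suc N ≡ suc k [mod 2 * k ] → ∃[ n ] N ≡ k * suc (2 * n)
N≡k*odd k N 1≤k 2k∣ with k ℕ.≤? N
... | yes k≤N with divides n N-k≡n*2k ← ≡.subst (2 * k ∣_) (ℕ.m≤n⇒∣n-m∣≡n∸m k≤N) 2k∣ = n , (begin
  N                   ≡⟨ ℕ.m+[n∸m]≡n k≤N ⟨
  k + (N ∸ k)         ≡⟨ ≡.cong (k +_) N-k≡n*2k ⟩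
  k + n * (2 * k)     ≡⟨ ≡.cong (k +_) (ℕ.*-assoc n 2 k) ⟨
  k + n * 2 * k       ≡⟨ ≡.cong (k +_) (≡.cong (_* k) (ℕ.*-comm n 2)) ⟩
  k + 2 * n * k       ≡⟨ ≡.cong (k +_) (ℕ.*-comm (2 * n) k) ⟩
  k + k * (2 * n)     ≡⟨ ℕ.*-suc k (2 * n) ⟨
  k * suc (2 * n)     ∎)
  where open ≡.≡-Reasoning
-- Here 0 < k - N ≤ k < 2k, so k - N is not a multiple of 2k.
... | no k≰N = contradiction (begin-strict
  k             <⟨ ℕ.m<m+n k 1≤k ⟩
  k + k         ≡⟨ ≡.cong (k +_) (ℕ.+-identityʳ k) ⟨
  2 * k         ≤⟨ ∣⇒≤ ⦃ >-nonZero (ℕ.m<n⇒0<n∸m N<k) ⦄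
                     (≡.subst (2 * k ∣_) (ℕ.m≤n⇒∣m-n∣≡n∸m (ℕ.<⇒≤ N<k)) 2k∣) ⟩
  k ∸ N         ≤⟨ ℕ.m∸n≤m k N ⟩
  k             ∎) (ℕ.<-irrefl ≡.refl)
  where
  open ℕ.≤-Reasoning
  N<k = ℕ.≰⇒> k≰N

mainTheorem6 : ∀ {a ℓ} (k m q : ℕ) →
    2 ≤ k → 2 ∣ k → 1 ≤ m →
    IsPrimePower q → q ≡ suc k [mod 2 * k ] →
    (F : FiniteField a ℓ q) →
    𝒦 m (paleyDigraph k F) ≡ 0 →
    ∀ R → IsRamseyNumber (replicate (k / 2) m) R → q < R
-- A field has an element, so q = 0 is impossible.
mainTheorem6 k m zero _ _ _ _ _ F _ _ _ = contradiction (FiniteField.index F (FiniteField.0# F)) ¬Fin0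
mainTheorem6 k@(suc k′) m (suc N) _ 2∣k@(divides c k≡c*2) _ _ q≡k+1 F 𝒦≡0 R (ramsey , _) =
  ℕ.≰⇒> λ R≤q →
    let n , N≡kd           = N≡k*odd k N (s≤s z≤n) q≡k+1
        rs , length≡c , reps = representatives {c} {n} k≡c*2 N≡kd
        length≡k/2         = ≡.trans length≡c (≡.sym (n/m≡quotient 2∣k))
        W , transitive     = ramsey⇒paley reps R≤q
          (≡.subst (λ t → RamseyProperty (replicate t m) R) (≡.sym length≡k/2) ramsey)
    in ℕ.<⇒≢ (𝒦>0 (paleyDigraph k F) transitive) (≡.sym 𝒦≡0)
  where
  open PowerClassCount k′ F
  open PaleyColouring k′ F
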